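{- Let $u_1, \ldots, u_n, v_1, \ldots, v_m \in \mathcal{L}_s$. Then $\max(u_1, \ldots, u_n) \leqslant_{\mathcal{L}} \max(v_1, \ldots, v_m)$ if and only if for every $i$ there exists $j$ such that $u_i \leqslant_{\mathcal{L}} v_j$.
   Context: $\mathcal{X}$ is a countable set of variables; a valuation is $\sigma\colon\mathcal{X}\to\mathbb{N}$. For finite $E\subseteq\mathcal{X}$, $x\in\mathcal{X}$, $S\in\mathbb{N}$, the sublevels $A(E,x,S)$ and $B(E,S)$ have values $[A(E,x,S)]_\sigma = 0$ if some $y\in E$ has $\sigma(y)=0$, and $\sigma(x)+S$ otherwise; $[B(E,S)]_\sigma=0$ if some $y\in E$ has $\sigma(y)=0$, and $S$ otherwise. $\mathcal{L}_s$ is the set of sublevels $A(E,x,S)$ with $x\in E$ and $B(E,S)$ with $S>0$. $\max$ of a finite family is evaluated pointwise (empty max has value $0$). $t_1\leqslant_{\mathcal{L}} t_2$ means $[t_1]_\sigma\le[t_2]_\sigma$ for every valuation $\sigma$. -}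

module Defs where

open import Data.Bool using (if_then_else_)
open import Data.List using (List)
open import Data.List.Membership.Propositional using (_∈_)
open import Data.List.Relation.Unary.Any using (any?)
open import Data.Nat using (ℕ; _+_; _⊔_; _≤_; _>_; _≟_)
open import Data.Vec.Functional using (Vector; foldr)
open import Relation.Nullary using (does)

Valuation : Set → Set
Valuation X = X → ℕ

-- The finite set E ⊆ X is represented by a list; order and multiplicity
-- are irrelevant, since E is only ever used through membership.
data Sublevel (X : Set) : Set where
  A : (E : List X) (x : X) (S : ℕ) → Sublevel X
  B : (E : List X) (S : ℕ) → Sublevel X

guard : {X : Set} → Valuation X → List X → ℕ → ℕ
guard σ E k = if does (any? (λ y → σ y ≟ 0) E) then 0 else k

value : {X : Set} → Sublevel X → Valuation X → ℕ
value (A E x S) σ = guard σ E (σ x + S)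
value (B E S)   σ = guard σ E S

data _∈ℒₛ {X : Set} : Sublevel X → Set where
  A∈ℒₛ : ∀ {E x S} → x ∈ E → A E x S ∈ℒₛ
  B∈ℒₛ : ∀ {E S} → S > 0 → B E S ∈ℒₛ

data Term (X : Set) : Set where
  sub : Sublevel X → Term X
  max : ∀ {n} → Vector (Sublevel X) n → Term X

⟦_⟧ : {X : Set} → Term X → Valuation X → ℕ
⟦ sub u ⟧ σ = value u σ
⟦ max u ⟧ σ = foldr _⊔_ 0 (λ i → value (u i) σ)

infix 4 _≤ℒ_

_≤ℒ_ : {X : Set} → Term X → Term X → Set
t₁ ≤ℒ t₂ = ∀ σ → ⟦ t₁ ⟧ σ ≤ ⟦ t₂ ⟧ σ

{-# OPTIONS --safe #-}

-- Each u_i is tested against max(v_1, …, v_m) on a single valuation vanishing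
-- outside its own guard set E.  Some v_j reaches the value of u_i there; as
-- this value is positive, the guard set of v_j lies in E.  For u_i = B(E,S) the
-- valuation is 1 on E, so v_j ≥ S wherever E is nonzero.  For u_i = A(E,x,S) it
-- is 1 on E except at x, where it exceeds every constant of the v's: then v_j
-- must itself be of the form A(F,x,T), with S ≤ T.
module Submission where

open import Data.Empty using (⊥-elim)
open import Data.Fin using (zero; suc)
open import Data.List using (List)
open import Data.List.Membership.Propositional using (_∈_; find; lose)
import Data.List.Membership.DecPropositional as DecMembership
open import Data.List.Relation.Binary.Subset.Propositional using (_⊆_)
open import Data.List.Relation.Unary.Any using (any?)
open import Data.Nat using (ℕ; zero; suc; _+_; _⊔_; _≤_; _<_; _≟_; z≤n; s≤s; z<s)
open import Data.Nat.Properties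
open import Data.Product using (∃; _×_; _,_)
open import Data.Sum using (inj₁; inj₂)
open import Data.Vec.Functional using (Vector; foldr)
open import Function.Base using (_∘_)
open import Function.Bundles using (_↣_; _⇔_; mk⇔)
open import Relation.Binary.Definitions using (DecidableEquality)
open import Relation.Binary.PropositionalEquality using (_≡_; refl; sym; subst)
open import Relation.Nullary using (yes; no)
open import Relation.Nullary.Decidable using (via-injection)

open import Defs

⨆ : ∀ {n} → Vector ℕ n → ℕ
⨆ = foldr _⊔_ 0

⨆-upper : ∀ {n} (f : Vector ℕ n) i → f i ≤ ⨆ f
⨆-upper f zero    = m≤m⊔n _ _
⨆-upper f (suc i) = ≤-trans (⨆-upper (f ∘ suc) i) (m≤n⊔m _ _)

⨆-least : ∀ {n k} (f : Vector ℕ n) → (∀ i → f i ≤ k) → ⨆ f ≤ k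
⨆-least {zero}  f f≤k = z≤n
⨆-least {suc n} f f≤k = ⊔-lub (f≤k zero) (⨆-least (f ∘ suc) (f≤k ∘ suc))

-- A nonempty maximum equals one of its entries. The empty one is `0`, which `0 < k` rules out.
⨆-reached : ∀ {n k} (f : Vector ℕ n) → 0 < k → k ≤ ⨆ f → ∃ λ i → k ≤ f i
⨆-reached {zero}  f 0<k k≤0 = ⊥-elim (<⇒≱ 0<k k≤0)
⨆-reached {suc n} f 0<k k≤⨆ with ⊔-sel (f zero) (⨆ (f ∘ suc))
... | inj₁ eq = zero , subst (_ ≤_) eq k≤⨆
... | inj₂ eq with i , k≤fi ← ⨆-reached (f ∘ suc) 0<k (subst (_ ≤_) eq k≤⨆) = suc i , k≤fi

constant : {X : Set} → Sublevel X → ℕ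
constant (A E x S) = S
constant (B E S)   = S

module _ {X : Set} where

  PositiveOn : List X → Valuation X → Set
  PositiveOn E σ = ∀ {y} → y ∈ E → 0 < σ y

  guard-open : ∀ σ E k → PositiveOn E σ → guard σ E k ≡ k
  guard-open σ E k pos with any? (λ y → σ y ≟ 0) E
  ... | no _  = refl
  ... | yes p with y , y∈E , σy≡0 ← find p = ⊥-elim (n>0⇒n≢0 (pos y∈E) σy≡0)

  guard-positive : ∀ σ E {k l} → 0 < l → l ≤ guard σ E k → PositiveOn E σ × l ≤ k
  guard-positive σ E 0<l l≤g with any? (λ y → σ y ≟ 0) E
  ... | yes _ = ⊥-elim (<⇒≱ 0<l l≤g)
  ... | no ¬p = (λ y∈E → n≢0⇒n>0 (¬p ∘ lose y∈E)) , l≤g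

  -- If `σ` vanishes somewhere on `E`, the left side is `0`. Otherwise `F ⊆ E` opens both guards,
  -- and only `k` and `l` remain to be compared.
  guard-mono : ∀ σ {E F k l} → F ⊆ E → (PositiveOn E σ → k ≤ l) → guard σ E k ≤ guard σ F l
  guard-mono σ {E} {F} {k} {l} F⊆E k≤l with any? (λ y → σ y ≟ 0) E
  ... | yes _ = z≤n
  ... | no ¬p = subst (k ≤_) (sym (guard-open σ F l (pos ∘ F⊆E))) (k≤l pos)
    where
    pos : PositiveOn E σ
    pos y∈E = n≢0⇒n>0 (¬p ∘ lose y∈E)

  max-mono : ∀ {n m} (u : Vector (Sublevel X) n) (v : Vector (Sublevel X) m) →
             (∀ i → ∃ λ j → sub (u i) ≤ℒ sub (v j)) → max u ≤ℒ max v
  max-mono u v u≤v σ = ⨆-least _ bound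
    where
    bound : ∀ i → value (u i) σ ≤ ⟦ max v ⟧ σ
    bound i with j , ui≤vj ← u≤v i = ≤-trans (ui≤vj σ) (⨆-upper _ j)

module _ {X : Set} (_≟ₓ_ : DecidableEquality X) where

  open DecMembership _≟ₓ_ using (_∈?_)

  restrict : List X → Valuation X → Valuation X
  restrict E h y with y ∈? E
  ... | yes _ = h y
  ... | no  _ = 0

  restrict-∈ : ∀ {E h y} → y ∈ E → restrict E h y ≡ h y
  restrict-∈ {E} {y = y} y∈E with y ∈? E
  ... | yes _  = refl
  ... | no y∉E = ⊥-elim (y∉E y∈E)

  restrict-≤ : ∀ E h y → restrict E h y ≤ h y
  restrict-≤ E h y with y ∈? E
  ... | yes _ = ≤-refl
  ... | no  _ = z≤n

  restrict-positive : ∀ E {h} → (∀ y → 0 < h y) → PositiveOn E (restrict E h)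
  restrict-positive E 0<h {y} y∈E = subst (0 <_) (sym (restrict-∈ y∈E)) (0<h y)

  restrict-support : ∀ E h {F} → PositiveOn F (restrict E h) → F ⊆ E
  restrict-support E h pos {y} y∈F with y ∈? E | pos y∈F
  ... | yes y∈E | _  = y∈E
  ... | no _    | ()

  spike : X → ℕ → Valuation X
  spike x N y with y ≟ₓ x
  ... | yes _ = N
  ... | no  _ = 1

  spike-centre : ∀ x N → spike x N x ≡ N
  spike-centre x N with x ≟ₓ x
  ... | yes _  = refl
  ... | no x≢x = ⊥-elim (x≢x refl)

  spike-positive : ∀ x {N} → 0 < N → ∀ y → 0 < spike x N y
  spike-positive x 0<N y with y ≟ₓ x
  ... | yes _ = 0<N
  ... | no  _ = z<s

  flat : Valuation X
  flat _ = 1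

  B-below : ∀ {E S} v → v ∈ℒₛ → 0 < S → S ≤ value v (restrict E flat) → sub (B E S) ≤ℒ sub v
  B-below {E} (A F y T) (A∈ℒₛ y∈F) 0<S S≤v σ with pos , S≤ ← guard-positive (restrict E flat) F 0<S S≤v =
    guard-mono σ F⊆E λ posE →
      -- The test valuation is at most `1` at `y`, so `S ≤ 1 + T`; and `1 ≤ σ y` because
      -- `y ∈ F ⊆ E`.
      ≤-trans S≤ (+-monoˡ-≤ T (≤-trans (restrict-≤ E flat y) (posE (F⊆E y∈F))))
    where
    F⊆E : F ⊆ E
    F⊆E = restrict-support E flat pos
  B-below {E} (B F T) _ 0<S S≤v σ with pos , S≤T ← guard-positive (restrict E flat) F 0<S S≤v =
    guard-mono σ (restrict-support E flat pos) λ _ → S≤T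

  -- A sublevel with constant `T` that does not read `x` has value at most `1 + T` on the test
  -- valuation, hence below `N`. Only an `A` based at `x` can reach `N + S`.
  A-below : ∀ {E x S N} v → 1 + constant v < N →
            N + S ≤ value v (restrict E (spike x N)) → sub (A E x S) ≤ℒ sub v
  A-below {E} {x} {S} {N} (A F y T) T<N N+S≤v σ
    with pos , N+S≤ ← guard-positive (restrict E (spike x N)) F (≤-trans (≤-trans z<s T<N) (m≤m+n N S)) N+S≤v
    -- Abstracting the bound along with the test turns `spike x N y` in its type into `N` or `1`.
    with y ≟ₓ x | ≤-trans N+S≤ (+-monoˡ-≤ T (restrict-≤ E (spike x N) y))
  ... | yes refl | N+S≤N+T =
    guard-mono σ (restrict-support E (spike x N) pos) λ _ → +-monoʳ-≤ (σ x) (+-cancelˡ-≤ N S T N+S≤N+T)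
  ... | no _ | N+S≤1+T = ⊥-elim (<⇒≱ T<N (≤-trans (m≤m+n N S) N+S≤1+T))
  A-below {E} {x} {S} {N} (B F T) T<N N+S≤v σ
    with _ , N+S≤T ← guard-positive (restrict E (spike x N)) F (≤-trans (≤-trans z<s T<N) (m≤m+n N S)) N+S≤v =
    ⊥-elim (<⇒≱ T<N (≤-trans (m≤m+n N S) (≤-trans N+S≤T (n≤1+n T))))

  -- The test valuation is positive on `E`, so the guard of `u` is open and its value there is
  -- positive: `S` in the `B` case, `N + S` in the `A` case. A single `v j` therefore attains it.
  below-component : ∀ {m} u (v : Vector (Sublevel X) m) → u ∈ℒₛ → (∀ j → v j ∈ℒₛ) →
                    sub u ≤ℒ max v → ∃ λ j → sub u ≤ℒ sub (v j)
  below-component (B E S) v (B∈ℒₛ 0<S) v∈ u≤v =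
    let j , S≤vj = ⨆-reached (λ j → value (v j) σ) 0<S S≤⨆ in j , B-below {E} (v j) (v∈ j) 0<S S≤vj
    where
    σ = restrict E flat

    S≤⨆ : S ≤ ⟦ max v ⟧ σ
    S≤⨆ = subst (_≤ ⟦ max v ⟧ σ) (guard-open σ E S (restrict-positive E λ _ → z<s)) (u≤v σ)
  below-component (A E x S) v (A∈ℒₛ x∈E) v∈ u≤v =
    let j , N+S≤vj = ⨆-reached (λ j → value (v j) σ) z<s N+S≤⨆
    in j , A-below {E} (v j) (s≤s (s≤s (⨆-upper (constant ∘ v) j))) N+S≤vj
    where
    -- One unit covers the value `1` taken away from `x`, the other makes the inequality
    -- `1 + constant (v j) < N` strict.
    N = 2 + ⨆ (constant ∘ v)
    σ = restrict E (spike x N)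

    value-u : value (A E x S) σ ≡ N + S
    value-u rewrite guard-open σ E (σ x + S) (restrict-positive E (spike-positive x z<s))
                  | restrict-∈ {h = spike x N} x∈E
                  | spike-centre x N = refl

    N+S≤⨆ : N + S ≤ ⟦ max v ⟧ σ
    N+S≤⨆ = subst (_≤ ⟦ max v ⟧ σ) value-u (u≤v σ)

theorem37 : (X : Set) → X ↣ ℕ →
    (n m : ℕ) (u : Vector (Sublevel X) n) (v : Vector (Sublevel X) m) →
    (∀ i → u i ∈ℒₛ) → (∀ j → v j ∈ℒₛ) →
    (max u ≤ℒ max v) ⇔ (∀ i → ∃ λ j → sub (u i) ≤ℒ sub (v j))
theorem37 X X↣ℕ n m u v u∈ v∈ = mk⇔
  -- The injection into `ℕ` makes equality on `X` decidable, as building the test valuations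
  -- requires.
  (λ u≤v i → below-component (via-injection X↣ℕ _≟_) (u i) v (u∈ i) v∈
               λ σ → ≤-trans (⨆-upper (λ k → value (u k) σ) i) (u≤v σ))
  (max-mono u v)
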